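{- For integers $n\ge 0$, $p\ge 0$, let $b_{n,p}$ be the number of permutations of length $n$ in $\mathcal{B}_p$ (equivalently, the number of permutations of length $n$ in $\bigcup_{q\ge0}\mathcal{B}_q$ having exactly $p+1$ non-left-to-right-maxima). Then for $p<n-2$, $$b_{n,p}=\sum_{\ell=0}^{p-1}(\ell+1)!\binom{n-2}{\ell}\,b_{n-\ell-2,\,p-\ell-1},$$ and moreover $b_{n,p}=0$ if $p<(n-2)/2$ or $p>n-2$, and $b_{n,n-2}=(n-1)!$ for $n>1$.
   Context: A right-jump transforms $\sigma=\sigma_1\cdots\sigma_n$ into $\sigma_1\cdots\sigma_{i-1}\sigma_{i+1}\cdots\sigma_j\,\sigma_i\,\sigma_{j+1}\cdots\sigma_n$ for some $1\le i<j\le n$. A left-to-right maximum of $\sigma$ is a value $\sigma_i$ with $\sigma_k\le\sigma_i$ for all $k\le i$; other values are non-left-to-right-maxima. A permutation $\pi$ is a pattern of $\sigma$ ($\pi\prec\sigma$) if some subsequence of $\sigma$ is order-isomorphic to $\pi$. $\mathcal{C}_p$ is the set of all permutations (of any length $n$) obtainable from the identity of length $n$ by at most $p$ right-jumps. $\mathcal{B}_p$ is the set of permutations $\sigma\notin\mathcal{C}_p$ such that every pattern $\pi\prec\sigma$ with $\pi\neq\sigma$ lies in $\mathcal{C}_p$. -}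

module Defs where

open import Data.Nat using (ℕ; zero; suc; _<_; _<?_)
open import Data.List using (List; []; _∷_; _++_; length; map; filter; upTo)
open import Data.List.Relation.Binary.Sublist.Propositional using (_⊆_)
open import Data.List.Relation.Binary.Permutation.Propositional using (_↭_)
open import Data.Fin using (Fin)
open import Data.Product using (Σ; ∃; _×_)
open import Relation.Nullary using (¬_)
open import Relation.Binary.PropositionalEquality using (_≡_; _≢_)
open import Function.Definitions using (Injective)

IsPerm : List ℕ → Set
IsPerm σ = σ ↭ upTo (length σ)

identity : ℕ → List ℕ
identity n = upTo n

-- One right-jump: σ = a ++ x ∷ b ++ c  ↦  a ++ b ++ x ∷ c  with b nonempty
-- (x = σ_i jumps to position j > i; b = σ_{i+1} ⋯ σ_j).
data RightJump : List ℕ → List ℕ → Set where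
  jump : (a : List ℕ) (x y : ℕ) (b c : List ℕ) →
         RightJump (a ++ x ∷ (y ∷ b) ++ c) (a ++ (y ∷ b) ++ x ∷ c)

data Reach : ℕ → List ℕ → List ℕ → Set where
  done : ∀ {k τ} → Reach k τ τ
  step : ∀ {k τ τ' σ} → RightJump τ τ' → Reach k τ' σ → Reach (suc k) τ σ

InC : ℕ → List ℕ → Set
InC p σ = Reach p (identity (length σ)) σ

-- Standardisation (the permutation order-isomorphic to a list of distinct values).
st : List ℕ → List ℕ
st s = map (λ x → length (filter (_<? x) s)) s

_≺_ : List ℕ → List ℕ → Set
π ≺ σ = Σ (List ℕ) (λ s → (s ⊆ σ) × (π ≡ st s))

InB : ℕ → List ℕ → Set
InB p σ = IsPerm σ × (¬ InC p σ) × (∀ π → π ≺ σ → π ≢ σ → InC p π)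

Counts : ℕ → (List ℕ → Set) → Set
Counts k P = Σ (Fin k → List ℕ) (λ f →
  Injective _≡_ _≡_ f × (∀ i → P (f i)) × (∀ σ → P σ → ∃ λ i → f i ≡ σ))

Bnp : ℕ → ℕ → List ℕ → Set
Bnp n p σ = (length σ ≡ n) × InB p σ

{-# OPTIONS --safe #-}

-- A right-jump creates at most one non-left-to-right-maximum, and any non-maximum can be made a
-- maximum by jumping it back to just before the first larger entry. So σ lies in C_p iff it has
-- at most p non-left-to-right-maxima, and in B_p iff it has p + 1 of them and deleting any entry
-- leaves fewer. Write such a σ of length m + 2 (values 0, …, m + 1) as α (m + 1) β. All entries
-- of β are non-maxima. Deleting m + 1 leaves fewer of them iff m ∈ β, and since a non-maximum in
-- β already has m + 1 above it, the entries of α are all needed iff α itself is minimal. Choosing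
-- the other ℓ entries of β, their order and α gives the recurrence.

module Submission where

open import Defs
open import Data.Nat
open import Data.Nat.Combinatorics using (_C_; nCk+nC[k+1]≡[n+1]C[k+1]; k>n⇒nCk≡0)
open import Data.Nat.Induction using (<-rec)
open import Data.Nat.ListAction using (sum)
open import Data.Nat.Properties
open import Data.Nat.Solver using (module +-*-Solver)
open import Data.Fin as Fin using (Fin; splitAt; join)
import Data.Fin.Properties as Finₚ
open import Data.List using (List; []; _∷_; _++_; length; map; filter; upTo; applyUpTo; tabulate)
open import Data.List.Properties
open import Data.List.Membership.DecPropositional _≟_ using (_∈?_)
open import Data.List.Membership.Propositional using (_∈_; _∉_)
open import Data.List.Membership.Propositional.Properties
open import Data.List.Relation.Binary.Equality.Propositional using (≋⇒≡)
open import Data.List.Relation.Binary.Permutation.Propositional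
  using (_↭_; prep; ↭-refl; ↭-sym; ↭-trans; ↭-reflexive; ↭⇒↭ₛ; module PermutationReasoning)
open import Data.List.Relation.Binary.Permutation.Propositional.Properties
  using (↭-map-inv; ↭-length; ∈-resp-↭; drop-∷; shift; ↭-empty-inv; filter-↭; ++⁺ʳ; ++⁺; ++-comm)
  renaming (map⁺ to ↭-map⁺)
import Data.List.Relation.Binary.Permutation.Setoid.Properties as PermSetoid
open import Data.List.Relation.Binary.Sublist.Propositional
  using (_⊆_; []; _∷_; _∷ʳ_; ⊆-refl; minimum)
open import Data.List.Relation.Binary.Sublist.Propositional.Properties
  using (All-resp-⊆; length-mono-≤; to-≋)
  renaming (++⁺ to ⊆-++⁺; map⁺ to ⊆-map⁺)
open import Data.List.Relation.Ternary.Interleaving.Propositional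
  using (Interleaving; []; consˡ; consʳ; toPermutation)
open import Data.List.Relation.Unary.All as All using (All; []; _∷_)
open import Data.List.Relation.Unary.All.Properties using (All¬⇒¬Any; all-upTo)
open import Data.List.Relation.Unary.AllPairs as AllPairs using (AllPairs; []; _∷_)
open import Data.List.Relation.Unary.AllPairs.Properties using (applyUpTo⁺₁)
open import Data.List.Relation.Unary.Any using (here; there)
open import Data.List.Relation.Unary.Sorted.TotalOrder.Properties using (AllPairs⇒Sorted; ↗↭↗⇒≋)
open import Data.List.Relation.Unary.Unique.Propositional using (Unique)
import Data.List.Relation.Unary.Unique.Propositional.Properties as Uniqueₚ
open import Data.Product using (Σ; ∃; _×_; _,_; proj₁; proj₂; map₁; map₂)
open import Data.Sum using (_⊎_; inj₁; inj₂; [_,_]′)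
open import Data.Empty using (⊥-elim)
open import Function using (_∘_; id)
open import Function.Definitions using (Injective)
open import Relation.Binary.Definitions using (tri<; tri≈; tri>)
open import Relation.Binary.PropositionalEquality hiding ([_])
open import Relation.Nullary
open import Relation.Nullary.Decidable using (decidable-stable)

private variable
  A B : Set
  k m n : ℕ

-- Counting by bijections with `Fin k`.

Unique-resp-↭ : {xs ys : List A} → xs ↭ ys → Unique xs → Unique ys
Unique-resp-↭ {A} = PermSetoid.Unique-resp-↭ (setoid A) ∘ ↭⇒↭ₛ

-- At lists of naturals this unfolds to the same type as `Counts`. Other element types are needed
-- because permutations are counted through tuples of pieces.
Card : ℕ → (A → Set) → Set
Card {A} k P = Σ (Fin k → A) λ f →
  Injective _≡_ _≡_ f × (∀ i → P (f i)) × (∀ x → P x → ∃ λ i → f i ≡ x)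

card-≤ : {P Q : A → Set} → Card k P → Card m Q → (∀ x → P x → Q x) → k ≤ m
card-≤ (f , f-inj , f∈ , _) (g , _ , _ , g-onto) P⇒Q = Finₚ.injective⇒≤ {f = index} index-inj
  where
  index = λ i → proj₁ (g-onto (f i) (P⇒Q _ (f∈ i)))
  index-inj : Injective _≡_ _≡_ index
  index-inj {i} {j} eq = f-inj (trans (sym (proj₂ (g-onto _ _))) (trans (cong g eq) (proj₂ (g-onto _ _))))

card-unique : {P Q : A → Set} → Card k P → Card m Q →
              (∀ x → P x → Q x) → (∀ x → Q x → P x) → k ≡ m
card-unique p q P⇒Q Q⇒P = ≤-antisym (card-≤ p q P⇒Q) (card-≤ q p Q⇒P)

card-∅ : {P : A → Set} → (∀ x → ¬ P x) → Card 0 P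
card-∅ ¬P = (λ ()) , (λ {}) , (λ ()) , λ x Px → ⊥-elim (¬P x Px)

card-singleton : {P : A → Set} (x : A) → P x → (∀ y → P y → x ≡ y) → Card 1 P
card-singleton x Px unique =
  (λ _ → x) , (λ { {Fin.zero} {Fin.zero} _ → refl }) , (λ _ → Px) , λ y Py → Fin.zero , unique y Py

-- Injectivity is asked for only on `P`: gluing pieces together, for instance, is injective on valid
-- pieces only.
card-image : {P : A → Set} {Q : B → Set} (g : A → B) →
             (∀ {x y} → P x → P y → g x ≡ g y → x ≡ y) →
             (∀ x → P x → Q (g x)) →
             (∀ y → Q y → ∃ λ x → P x × g x ≡ y) →
             Card k P → Card k Q
card-image g g-inj P⇒Q onto (f , f-inj , f∈ , f-onto) =
  g ∘ f , f-inj ∘ g-inj (f∈ _) (f∈ _) , (λ i → P⇒Q _ (f∈ i)) , λ y Qy →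
    let x , Px , gx≡y = onto y Qy
        i , fi≡x = f-onto x Px
    in i , trans (cong g fi≡x) gx≡y

card-⇔ : {P Q : A → Set} → (∀ x → P x → Q x) → (∀ x → Q x → P x) → Card k P → Card k Q
card-⇔ P⇒Q Q⇒P = card-image id (λ _ _ → id) P⇒Q (λ y Qy → y , Q⇒P y Qy , refl)

card-⊎ : {P Q : A → Set} → (∀ x → P x → ¬ Q x) → Card k P → Card m Q → Card (k + m) (λ x → P x ⊎ Q x)
card-⊎ {A} {k} {m} {P} {Q} disjoint (f , f-inj , f∈ , f-onto) (g , g-inj , g∈ , g-onto) =
  h ∘ splitAt k
  , (λ {i} {j} eq → trans (sym (Finₚ.join-splitAt k m i))
                      (trans (cong (join k m) (h-inj (splitAt k i) (splitAt k j) eq))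
                        (Finₚ.join-splitAt k m j)))
  , h∈ ∘ splitAt k
  , onto
  where
  h : Fin k ⊎ Fin m → A
  h = [ f , g ]′
  h∈ : ∀ i → P (h i) ⊎ Q (h i)
  h∈ (inj₁ i) = inj₁ (f∈ i)
  h∈ (inj₂ i) = inj₂ (g∈ i)
  h-inj : ∀ i j → h i ≡ h j → i ≡ j
  h-inj (inj₁ i) (inj₁ j) eq = cong inj₁ (f-inj eq)
  h-inj (inj₁ i) (inj₂ j) eq = ⊥-elim (disjoint _ (f∈ i) (subst Q (sym eq) (g∈ j)))
  h-inj (inj₂ i) (inj₁ j) eq = ⊥-elim (disjoint _ (f∈ j) (subst Q eq (g∈ i)))
  h-inj (inj₂ i) (inj₂ j) eq = cong inj₂ (g-inj eq)
  onto : ∀ x → P x ⊎ Q x → ∃ λ i → h (splitAt k i) ≡ x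
  onto x (inj₁ Px) = let i , eq = f-onto x Px in
    join k m (inj₁ i) , trans (cong h (Finₚ.splitAt-join k m (inj₁ i))) eq
  onto x (inj₂ Qx) = let i , eq = g-onto x Qx in
    join k m (inj₂ i) , trans (cong h (Finₚ.splitAt-join k m (inj₂ i))) eq

card-∈ : {xs : List A} → Unique xs → Card (length xs) (_∈ xs)
card-∈ [] = card-∅ λ _ ()
card-∈ {xs = x ∷ xs} (x∉ ∷ u) =
  card-⇔ (λ { _ (inj₁ refl) → here refl ; _ (inj₂ y∈) → there y∈ })
         (λ { _ (here refl) → inj₁ refl ; _ (there y∈) → inj₂ y∈ })
    (card-⊎ {P = x ≡_} (λ { _ refl → All¬⇒¬Any x∉ })
      (card-singleton x refl (λ _ → id)) (card-∈ u))

-- Fibres may differ in size, so their sizes are summed. The sum over ℓ in the recurrence arises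
-- here.
card-Σ : {xs : List A} {c : A → ℕ} {Q : A → B → Set} → Unique xs →
         (∀ {x} → x ∈ xs → Card (c x) (Q x)) →
         Card (sum (map c xs)) (λ (x , y) → x ∈ xs × Q x y)
card-Σ [] _ = card-∅ λ { _ (() , _) }
card-Σ {xs = x ∷ xs} {Q = Q} (x∉ ∷ u) fibre =
  card-⇔ (λ { _ (inj₁ (refl , q)) → here refl , q ; _ (inj₂ (y∈ , q)) → there y∈ , q })
         (λ { _ (here refl , q) → inj₁ (refl , q) ; _ (there y∈ , q) → inj₂ (y∈ , q) })
    (card-⊎ {P = λ (y , z) → x ≡ y × Q y z} (λ { _ (refl , _) (x∈ , _) → All¬⇒¬Any x∉ x∈ })
      (card-image (x ,_) (λ { _ _ refl → refl }) (λ _ q → refl , q)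
                  (λ { _ (refl , q) → _ , q , refl }) (fibre (here refl)))
      (card-Σ u (fibre ∘ there)))

sum-const : ∀ c (xs : List A) → sum (map (λ _ → c) xs) ≡ length xs * c
sum-const c [] = refl
sum-const c (x ∷ xs) = cong (c +_) (sum-const c xs)

-- The second set may depend on the first component as long as its size does not; the sum of fibre
-- sizes is then a product.
card-× : {P : A → Set} {Q : A → B → Set} → Card k P → (∀ {x} → P x → Card m (Q x)) →
         Card (k * m) (λ (x , y) → P x × Q x y)
card-× {k = k} {m} {P} {Q} (f , f-inj , f∈ , f-onto) fibre =
  subst (λ c → Card c (λ (x , y) → P x × Q x y))
        (trans (sum-const m (tabulate f)) (cong (_* m) (length-tabulate f)))
        (card-⇔ (λ (x , y) (x∈ , q) → ∈⇒P x∈ , q)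
                (λ (x , y) (Px , q) → P⇒∈ (f-onto x Px) , q)
          (card-Σ (Uniqueₚ.tabulate⁺ f-inj) (fibre ∘ ∈⇒P)))
  where
  ∈⇒P : ∀ {x} → x ∈ tabulate f → P x
  ∈⇒P x∈ with i , refl ← ∈-tabulate⁻ x∈ = f∈ i
  P⇒∈ : ∀ {x} → (∃ λ i → f i ≡ x) → x ∈ tabulate f
  P⇒∈ (i , refl) = ∈-tabulate⁺ i

-- Counting rearrangements and splittings of a list.

∈⇒↭∷ : {x : A} {xs : List A} → x ∈ xs → ∃ λ ys → xs ↭ x ∷ ys
∈⇒↭∷ x∈ with ys , zs , refl ← ∈-∃++ x∈ = ys ++ zs , shift _ ys zs

-- The head can be any of the n entries, and the tail is a rearrangement of the others.
card-↭ : ∀ n {xs : List A} → Unique xs → length xs ≡ n → Card (n !) (_↭ xs)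
card-↭ zero {[]} _ _ = card-singleton [] ↭-refl λ ys ys↭[] → sym (↭-empty-inv ys↭[])
card-↭ {A} (suc n) {xs} u |xs|≡1+n =
  card-image (λ (y , ys) → y ∷ ys)
    (λ _ _ eq → cong₂ _,_ (∷-injectiveˡ eq) (∷-injectiveʳ eq))
    (λ _ → proj₂)
    (λ { [] []↭xs → contradiction (trans (↭-length []↭xs) |xs|≡1+n) λ ()
       ; (y ∷ ys) y∷ys↭xs → (y , ys) , (∈-resp-↭ y∷ys↭xs (here refl) , y∷ys↭xs) , refl })
    (subst (λ c → Card (c * n !) (λ (y , ys) → y ∈ xs × y ∷ ys ↭ xs)) |xs|≡1+n
      (card-× (card-∈ u) tails))
  where
  tails : ∀ {y} → y ∈ xs → Card (n !) (λ ys → y ∷ ys ↭ xs)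
  tails {y} y∈ with zs , xs↭ ← ∈⇒↭∷ y∈ with _ ∷ u′ ← Unique-resp-↭ xs↭ u =
    card-⇔ (λ ys ys↭zs → ↭-trans (prep y ys↭zs) (↭-sym xs↭))
           (λ ys y∷ys↭xs → drop-∷ (↭-trans y∷ys↭xs xs↭))
      (card-↭ n u′ (suc-injective (trans (sym (↭-length xs↭)) |xs|≡1+n)))

interleaving-∈ˡ : {x : A} {xs ys zs : List A} → Interleaving ys zs xs → x ∈ ys → x ∈ xs
interleaving-∈ˡ i x∈ = ∈-resp-↭ (↭-sym (toPermutation i)) (∈-++⁺ˡ x∈)

interleaving-∈ʳ : {x : A} {xs ys zs : List A} → Interleaving ys zs xs → x ∈ zs → x ∈ xs
interleaving-∈ʳ {ys = ys} i x∈ = ∈-resp-↭ (↭-sym (toPermutation i)) (∈-++⁺ʳ ys x∈)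

-- When the entries are distinct this is the choice of an l-element subset: both it and its
-- complement are kept in the order of `xs`.
Split : List A → ℕ → List A × List A → Set
Split xs l (ys , zs) = Interleaving ys zs xs × length ys ≡ l

-- Pascal's rule: the first entry goes either to the chosen part or to the rest.
card-Split : {xs : List A} → Unique xs → ∀ l → Card (length xs C l) (Split xs l)
card-Split [] zero = card-singleton ([] , []) ([] , refl) λ { _ ([] , _) → refl }
card-Split {A = A} {xs = []} [] (suc l) =
  subst (λ c → Card c (Split {A} [] (suc l))) (sym (k>n⇒nCk≡0 {n = 0} {suc l} (s≤s z≤n)))
    (card-∅ λ { _ ([] , ()) })
card-Split {xs = x ∷ xs} (_ ∷ u) zero =
  card-image (map₂ (x ∷_))
    (λ { _ _ refl → refl })
    (λ _ (i , eq) → consʳ i , eq)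
    (λ { _ (consʳ i , eq) → _ , (i , eq) , refl ; _ (consˡ i , ()) })
    (card-Split u zero)
card-Split {xs = x ∷ xs} (x∉ ∷ u) (suc l) =
  subst (λ c → Card c (Split (x ∷ xs) (suc l))) (nCk+nC[k+1]≡[n+1]C[k+1] (length xs) l)
    (card-⇔ (λ _ → [ proj₁ , proj₁ ]′)
            (λ { _ s@(consˡ i , refl) → inj₁ (s , here refl)
               ; _ s@(consʳ i , _) → inj₂ (s , All¬⇒¬Any x∉ ∘ interleaving-∈ˡ i) })
      -- Since `x` does not recur in `xs`, membership of `x` in the chosen part separates the two
      -- cases.
      (card-⊎ {P = λ s → Split (x ∷ xs) (suc l) s × x ∈ proj₁ s}
              {Q = λ s → Split (x ∷ xs) (suc l) s × x ∉ proj₁ s}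
        (λ _ (_ , x∈) (_ , x∉) → x∉ x∈)
        (card-image (map₁ (x ∷_))
          (λ { _ _ refl → refl })
          (λ _ (i , eq) → (consˡ i , cong suc eq) , here refl)
          (λ { _ ((consˡ i , eq) , _) → _ , (i , suc-injective eq) , refl
             ; _ ((consʳ i , _) , x∈) → contradiction (interleaving-∈ˡ i x∈) (All¬⇒¬Any x∉) })
          (card-Split u l))
        (card-image (map₂ (x ∷_))
          (λ { _ _ refl → refl })
          (λ _ (i , eq) → (consʳ i , eq) , All¬⇒¬Any x∉ ∘ interleaving-∈ˡ i)
          (λ { _ ((consʳ i , eq) , _) → _ , (i , eq) , refl
             ; _ ((consˡ i , _) , x∉) → contradiction (here refl) x∉ })
          (card-Split u (suc l)))))

-- The number of non-left-to-right-maxima.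

χ : {P : Set} → Dec P → ℕ
χ (yes _) = 1
χ (no _)  = 0

χ-mono : {P Q : Set} (p? : Dec P) (q? : Dec Q) → (P → Q) → χ p? ≤ χ q?
χ-mono (yes p) (yes q) _ = ≤-refl
χ-mono (yes p) (no ¬q) P⇒Q = contradiction (P⇒Q p) ¬q
χ-mono (no _)  _       _ = z≤n

χ-cong : {P Q : Set} (p? : Dec P) (q? : Dec Q) → (P → Q) → (Q → P) → χ p? ≡ χ q?
χ-cong p? q? P⇒Q Q⇒P = ≤-antisym (χ-mono p? q? P⇒Q) (χ-mono q? p? Q⇒P)

χ≤1 : {P : Set} (p? : Dec P) → χ p? ≤ 1
χ≤1 (yes _) = ≤-refl
χ≤1 (no _)  = z≤n

χ-yes : {P : Set} (p? : Dec P) → P → χ p? ≡ 1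
χ-yes (yes _) _ = refl
χ-yes (no ¬p) p = contradiction p ¬p

χ-no : {P : Set} (p? : Dec P) → ¬ P → χ p? ≡ 0
χ-no (yes p) ¬p = contradiction p ¬p
χ-no (no _)  _  = refl

-- The number of non-left-to-right-maxima of xs when it is preceded by entries with maximum t.
nlr : ℕ → List ℕ → ℕ
nlr t []       = 0
nlr t (x ∷ xs) = χ (x <? t) + nlr (t ⊔ x) xs

-- The running maximum with which `nlr` continues behind `xs`.
peak : ℕ → List ℕ → ℕ
peak t []       = t
peak t (x ∷ xs) = peak (t ⊔ x) xs

nlr-++ : ∀ t xs ys → nlr t (xs ++ ys) ≡ nlr t xs + nlr (peak t xs) ys
nlr-++ t []       ys = refl
nlr-++ t (x ∷ xs) ys =
  trans (cong (χ (x <? t) +_) (nlr-++ (t ⊔ x) xs ys)) (sym (+-assoc (χ (x <? t)) _ _))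

peak-⊔ : ∀ t u xs → peak (t ⊔ u) xs ≡ peak t xs ⊔ u
peak-⊔ t u []       = refl
peak-⊔ t u (x ∷ xs) = trans (cong (λ v → peak v xs) ⊔-swap) (peak-⊔ (t ⊔ x) u xs)
  where
  ⊔-swap : t ⊔ u ⊔ x ≡ t ⊔ x ⊔ u
  ⊔-swap = trans (⊔-assoc t u x) (trans (cong (t ⊔_) (⊔-comm u x)) (sym (⊔-assoc t x u)))

peak-≤ : ∀ {t u xs} → t ≤ u → All (_≤ u) xs → peak t xs ≤ u
peak-≤ t≤u []          = t≤u
peak-≤ t≤u (x≤u ∷ xs≤) = peak-≤ (⊔-lub t≤u x≤u) xs≤

≤-peak : ∀ t xs → t ≤ peak t xs
≤-peak t []       = ≤-refl
≤-peak t (x ∷ xs) = ≤-trans (m≤m⊔n t x) (≤-peak (t ⊔ x) xs)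

∈⇒≤peak : ∀ t {x xs} → x ∈ xs → x ≤ peak t xs
∈⇒≤peak t {xs = y ∷ xs} (here refl) = ≤-trans (m≤n⊔m t y) (≤-peak (t ⊔ y) xs)
∈⇒≤peak t {xs = y ∷ xs} (there x∈)  = ∈⇒≤peak (t ⊔ y) x∈

-- Raising the threshold only creates non-maxima, and an additional entry only raises the threshold
-- for those after it.
nlr-mono : ∀ {t u xs ys} → t ≤ u → xs ⊆ ys → nlr t xs ≤ nlr u ys
nlr-mono t≤u [] = z≤n
nlr-mono {t} {u} t≤u (y ∷ʳ xs⊆ys) =
  ≤-trans (nlr-mono (≤-trans t≤u (m≤m⊔n u y)) xs⊆ys) (m≤n+m _ (χ (y <? u)))
nlr-mono {t} {u} {x ∷ _} t≤u (refl ∷ xs⊆ys) =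
  +-mono-≤ (χ-mono (x <? t) (x <? u) λ x<t → <-≤-trans x<t t≤u)
           (nlr-mono (⊔-monoˡ-≤ x t≤u) xs⊆ys)

nlr-≤-length : ∀ t xs → nlr t xs ≤ length xs
nlr-≤-length t []       = z≤n
nlr-≤-length t (x ∷ xs) = +-mono-≤ (χ≤1 (x <? t)) (nlr-≤-length (t ⊔ x) xs)

-- Either `x` is a maximum itself, or the first earlier entry exceeding `x` is one.
nlr-<-length : ∀ {t x xs} → x ∈ xs → t ≤ x → nlr t xs < length xs
nlr-<-length {t} {x} {_ ∷ xs} (here refl) t≤x =
  s≤s (subst (_≤ length xs) (cong (_+ nlr (t ⊔ x) xs) (sym (χ-no (x <? t) (≤⇒≯ t≤x))))
    (nlr-≤-length (t ⊔ x) xs))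
nlr-<-length {t} {x} {y ∷ xs} (there x∈) t≤x with y ≤? x
... | yes y≤x = subst (_≤ suc (length xs)) (+-suc (χ (y <? t)) _)
      (+-mono-≤ (χ≤1 (y <? t)) (nlr-<-length x∈ (⊔-lub t≤x y≤x)))
... | no y≰x = s≤s (subst (_≤ length xs) (cong (_+ nlr (t ⊔ y) xs) (sym (χ-no (y <? t) (≤⇒≯ t≤y))))
      (nlr-≤-length (t ⊔ y) xs))
  where t≤y = ≤-trans t≤x (≰⇒≥ y≰x)

nlr-0-<-length : ∀ x xs → nlr 0 (x ∷ xs) < length (x ∷ xs)
nlr-0-<-length x xs = nlr-<-length {xs = x ∷ xs} (here refl) z≤n

nlr≡length : ∀ {t xs} → All (_< t) xs → nlr t xs ≡ length xs
nlr≡length [] = refl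
nlr≡length {t} {x ∷ xs} (x<t ∷ xs<t) =
  cong₂ _+_ (χ-yes (x <? t) x<t)
    (trans (cong (λ u → nlr u xs) (m≥n⇒m⊔n≡m (<⇒≤ x<t))) (nlr≡length xs<t))

-- The first non-maximum is deleted. It does not affect the running maximum, so no other entry
-- changes its status.
drop-nonmax : ∀ t xs → 0 < nlr t xs → ∃ λ ys → ys ⊆ xs × suc (nlr t ys) ≡ nlr t xs
drop-nonmax t (x ∷ xs) 0<nlr with x <? t in eq
... | yes x<t = xs , x ∷ʳ ⊆-refl , cong (λ u → suc (nlr u xs)) (sym (m≥n⇒m⊔n≡m (<⇒≤ x<t)))
... | no  _ with ys , ys⊆xs , nlr-ys ← drop-nonmax (t ⊔ x) xs 0<nlr =
      x ∷ ys , refl ∷ ys⊆xs , trans (cong (λ d → suc (χ d + nlr (t ⊔ x) ys)) eq) nlr-ys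

-- Right-jumps and their undoing.

nlr-insert : ∀ t x xs → nlr t (x ∷ xs) ≤ suc (nlr (t ⊔ x) xs)
nlr-insert t x xs = +-monoˡ-≤ _ (χ≤1 (x <? t))

-- Moving x to the right changes the status of no other entry from maximum to non-maximum.
nlr-jump : ∀ {σ τ} → RightJump σ τ → nlr 0 τ ≤ suc (nlr 0 σ)
nlr-jump (jump as x y bs cs) = begin
  nlr 0 (as ++ b ++ x ∷ cs)                          ≡⟨ nlr-++ 0 as _ ⟩
  nlr 0 as + nlr t (b ++ x ∷ cs)                     ≡⟨ cong (nlr 0 as +_) (nlr-++ t b _) ⟩
  nlr 0 as + (nlr t b + nlr (peak t b) (x ∷ cs))
    ≤⟨ +-monoʳ-≤ (nlr 0 as) (+-monoʳ-≤ (nlr t b) (nlr-insert (peak t b) x cs)) ⟩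
  nlr 0 as + (nlr t b + suc (nlr (peak t b ⊔ x) cs)) ≡⟨ cong (nlr 0 as +_) (+-suc (nlr t b) _) ⟩
  nlr 0 as + suc (nlr t b + nlr (peak t b ⊔ x) cs)   ≡⟨ +-suc (nlr 0 as) _ ⟩
  suc (nlr 0 as + (nlr t b + nlr (peak t b ⊔ x) cs))
    ≡⟨ cong (λ u → suc (nlr 0 as + (nlr t b + nlr u cs))) (peak-⊔ t x b) ⟨
  suc (nlr 0 as + (nlr t b + nlr (peak (t ⊔ x) b) cs))
    ≤⟨ s≤s (+-monoʳ-≤ (nlr 0 as) (+-monoˡ-≤ _ (nlr-mono {ys = b} (m≤m⊔n t x) ⊆-refl))) ⟩
  suc (nlr 0 as + (nlr (t ⊔ x) b + nlr (peak (t ⊔ x) b) cs))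
    ≡⟨ cong (λ k → suc (nlr 0 as + k)) (nlr-++ (t ⊔ x) b cs) ⟨
  suc (nlr 0 as + nlr (t ⊔ x) (b ++ cs))             ≤⟨ s≤s (+-monoʳ-≤ (nlr 0 as) (m≤n+m _ (χ (x <? t)))) ⟩
  suc (nlr 0 as + nlr t (x ∷ b ++ cs))               ≡⟨ cong suc (nlr-++ 0 as _) ⟨
  suc (nlr 0 (as ++ x ∷ b ++ cs))                    ∎
  where
  open ≤-Reasoning
  b = y ∷ bs
  t = peak 0 as

-- Here `y` is the first entry above `x`, since `t` and all of `as` are at most `x`. Moving `x` to
-- just before `y` undoes a right-jump.
data Descent (t : ℕ) : List ℕ → Set where
  descent : ∀ as {y} bs {x} cs → peak t as ≤ x → x < y → Descent t (as ++ y ∷ bs ++ x ∷ cs)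

-- The first alternative covers a non-maximum whose larger predecessor lies before `xs`; it cannot
-- occur for threshold 0.
find-descent : ∀ t xs → 0 < nlr t xs →
  (∃ λ bs → ∃ λ x → ∃ λ cs → xs ≡ bs ++ x ∷ cs × x < t) ⊎ Descent t xs
find-descent t (y ∷ xs) 0<nlr with y <? t
... | yes y<t = inj₁ ([] , y , xs , refl , y<t)
... | no  y≮t with find-descent (t ⊔ y) xs 0<nlr
...   | inj₂ (descent as bs cs peak≤ x<y) = inj₂ (descent (y ∷ as) bs cs peak≤ x<y)
...   | inj₁ (bs , x , cs , refl , x<t⊔y) with x <? t
...     | yes x<t = inj₁ (y ∷ bs , x , cs , refl , x<t)
-- `x` is below `t ⊔ y` but not below `t`, so `y` is the first entry above it.
...     | no  x≮t = inj₂ (descent [] bs cs (≮⇒≥ x≮t)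
            (subst (x <_) (m≤n⇒m⊔n≡n (≮⇒≥ y≮t)) x<t⊔y))

-- Before `y`, the entry `x` is a maximum. `y` remains one because it is larger, and from `y` on the
-- running maximum is the same with or without `x`.
nlr-descent : ∀ as y bs x cs → peak 0 as ≤ x → x < y →
  suc (nlr 0 (as ++ x ∷ (y ∷ bs) ++ cs)) ≡ nlr 0 (as ++ (y ∷ bs) ++ x ∷ cs)
nlr-descent as y bs x cs t≤x x<y = begin
  suc (nlr 0 (as ++ x ∷ y ∷ bs ++ cs))              ≡⟨ cong suc (nlr-++ 0 as _) ⟩
  suc (nlr 0 as + nlr t (x ∷ y ∷ bs ++ cs))         ≡⟨ +-suc (nlr 0 as) _ ⟨
  nlr 0 as + suc (nlr t (x ∷ y ∷ bs ++ cs))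
    ≡⟨ cong (nlr 0 as +_) (trans (cong suc before) (sym after)) ⟩
  nlr 0 as + nlr t (y ∷ bs ++ x ∷ cs)               ≡⟨ nlr-++ 0 as _ ⟨
  nlr 0 (as ++ y ∷ bs ++ x ∷ cs)                    ∎
  where
  open ≡-Reasoning
  t = peak 0 as
  t≤y = ≤-trans t≤x (<⇒≤ x<y)
  x<peak = <-≤-trans x<y (≤-peak y bs)
  before : nlr t (x ∷ y ∷ bs ++ cs) ≡ nlr y bs + nlr (peak y bs) cs
  before = begin
    nlr t (x ∷ y ∷ bs ++ cs)
      ≡⟨ cong₂ (λ i u → i + nlr u (y ∷ bs ++ cs)) (χ-no (x <? t) (≤⇒≯ t≤x)) (m≤n⇒m⊔n≡n t≤x) ⟩
    nlr x (y ∷ bs ++ cs)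
      ≡⟨ cong₂ (λ i u → i + nlr u (bs ++ cs)) (χ-no (y <? x) (<⇒≯ x<y)) (m≤n⇒m⊔n≡n (<⇒≤ x<y)) ⟩
    nlr y (bs ++ cs)
      ≡⟨ nlr-++ y bs cs ⟩
    nlr y bs + nlr (peak y bs) cs ∎
  after : nlr t (y ∷ bs ++ x ∷ cs) ≡ suc (nlr y bs + nlr (peak y bs) cs)
  after = begin
    nlr t (y ∷ bs ++ x ∷ cs)
      ≡⟨ cong₂ (λ i u → i + nlr u (bs ++ x ∷ cs)) (χ-no (y <? t) (≤⇒≯ t≤y)) (m≤n⇒m⊔n≡n t≤y) ⟩
    nlr y (bs ++ x ∷ cs)
      ≡⟨ nlr-++ y bs (x ∷ cs) ⟩
    nlr y bs + nlr (peak y bs) (x ∷ cs)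
      ≡⟨ cong (nlr y bs +_) (cong₂ (λ i u → i + nlr u cs) (χ-yes (x <? peak y bs) x<peak)
           (m≥n⇒m⊔n≡m (<⇒≤ x<peak))) ⟩
    nlr y bs + suc (nlr (peak y bs) cs)
      ≡⟨ +-suc (nlr y bs) _ ⟩
    suc (nlr y bs + nlr (peak y bs) cs) ∎

undo-jump : ∀ σ → 0 < nlr 0 σ → ∃ λ τ → RightJump τ σ × suc (nlr 0 τ) ≡ nlr 0 σ
undo-jump σ 0<nlr with find-descent 0 σ 0<nlr
... | inj₂ (descent as bs cs peak≤ x<y) = _ , jump as _ _ bs cs , nlr-descent as _ bs _ cs peak≤ x<y

nlr≡0⇒sorted : ∀ t xs → nlr t xs ≡ 0 → All (t ≤_) xs × AllPairs _≤_ xs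
nlr≡0⇒sorted t []       _ = [] , []
nlr≡0⇒sorted t (x ∷ xs) eq with x <? t
... | no x≮t with ≤xs , sorted ← nlr≡0⇒sorted (t ⊔ x) xs eq =
      (≮⇒≥ x≮t ∷ All.map (≤-trans (m≤m⊔n t x)) ≤xs) , (All.map (≤-trans (m≤n⊔m t x)) ≤xs ∷ sorted)

m<n⊔o⇒m<n⊎m<o : ∀ {m} n o → m < n ⊔ o → m < n ⊎ m < o
m<n⊔o⇒m<n⊎m<o {m} n o m<n⊔o with ⊔-sel n o
... | inj₁ eq = inj₁ (subst (m <_) eq m<n⊔o)
... | inj₂ eq = inj₂ (subst (m <_) eq m<n⊔o)

sorted⇒nlr≡0 : ∀ {t xs} → All (t ≤_) xs → AllPairs _≤_ xs → nlr t xs ≡ 0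
sorted⇒nlr≡0 [] _ = refl
sorted⇒nlr≡0 {t} {x ∷ xs} (t≤x ∷ _) (x≤xs ∷ sorted) =
  cong₂ _+_ (χ-no (x <? t) (≤⇒≯ t≤x))
    (trans (cong (λ u → nlr u xs) (m≤n⇒m⊔n≡n t≤x)) (sorted⇒nlr≡0 x≤xs sorted))

-- Minimal lists and their maximum.

⊆-length-≤⇒≡ : {A : Set} {xs ys : List A} → xs ⊆ ys → length ys ≤ length xs → xs ≡ ys
⊆-length-≤⇒≡ xs⊆ys |ys|≤|xs| = ≋⇒≡ (to-≋ (≤-antisym (length-mono-≤ xs⊆ys) |ys|≤|xs|) xs⊆ys)

⊆-++⁻ : {A : Set} (xs : List A) {ys zs : List A} → zs ⊆ xs ++ ys →
        ∃ λ us → ∃ λ vs → zs ≡ us ++ vs × us ⊆ xs × vs ⊆ ys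
⊆-++⁻ [] {zs = zs} zs⊆ = [] , zs , refl , [] , zs⊆
⊆-++⁻ (x ∷ xs) (.x ∷ʳ zs⊆) with us , vs , eq , us⊆ , vs⊆ ← ⊆-++⁻ xs zs⊆ =
  us , vs , eq , x ∷ʳ us⊆ , vs⊆
⊆-++⁻ (x ∷ xs) (refl ∷ zs⊆) with us , vs , eq , us⊆ , vs⊆ ← ⊆-++⁻ xs zs⊆ =
  x ∷ us , vs , cong (x ∷_) eq , refl ∷ us⊆ , vs⊆

-- The set B_p consists of the permutations that are Minimal (suc p): patterns are
-- standardised sublists, and standardisation does not change the order relations.
Minimal : ℕ → List ℕ → Set
Minimal k σ = k ≤ nlr 0 σ × (∀ {s} → s ⊆ σ → k ≤ nlr 0 s → s ≡ σ)

minimal-0 : Minimal 0 []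
minimal-0 = z≤n , λ { [] _ → refl }

minimal-0⁻ : ∀ {σ} → Minimal 0 σ → σ ≡ []
minimal-0⁻ (_ , min) = sym (min (minimum _) z≤n)

-- With more than k non-maxima, one of them could be dropped and k would still be reached.
minimal-nlr : ∀ {k σ} → Minimal k σ → nlr 0 σ ≡ k
minimal-nlr {k} {σ} (k≤ , min) with m≤n⇒m<n∨m≡n k≤
... | inj₂ k≡ = sym k≡
... | inj₁ k<
  with s , s⊆σ , nlr-s ← drop-nonmax 0 σ (≤-<-trans z≤n k<)
  with refl ← min s⊆σ (s≤s⁻¹ (subst (k <_) (sym nlr-s) k<)) =
  contradiction nlr-s 1+n≢n

-- `N` exceeds everything before it, and everything after it is a non-maximum.
nlr-split : ∀ as {N bs} → All (_< N) as → All (_< N) bs → nlr 0 (as ++ N ∷ bs) ≡ nlr 0 as + length bs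
nlr-split as {N} {bs} as<N bs<N = begin
  nlr 0 (as ++ N ∷ bs)        ≡⟨ nlr-++ 0 as (N ∷ bs) ⟩
  nlr 0 as + nlr t (N ∷ bs)
    ≡⟨ cong (nlr 0 as +_) (cong₂ (λ i u → i + nlr u bs) (χ-no (N <? t) (≤⇒≯ t≤N)) (m≤n⇒m⊔n≡n t≤N)) ⟩
  nlr 0 as + nlr N bs         ≡⟨ cong (nlr 0 as +_) (nlr≡length bs<N) ⟩
  nlr 0 as + length bs        ∎
  where
  open ≡-Reasoning
  t = peak 0 as
  t≤N = peak-≤ {0} z≤n (All.map <⇒≤ as<N)

-- All of `bs` counts whatever precedes `N`, so any part of `as` with as many non-maxima could
-- replace `as`.
minimal-prefix : ∀ {k} as {N bs} → All (_< N) as → All (_< N) bs →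
                 Minimal k (as ++ N ∷ bs) → Minimal (nlr 0 as) as
minimal-prefix {k} as {N} {bs} as<N bs<N minimal@(_ , min) = ≤-refl , λ {s} s⊆as nlr-as≤ →
  ++-cancelʳ (N ∷ bs) s as (min (⊆-++⁺ s⊆as ⊆-refl) (begin
    k                      ≡⟨ minimal-nlr minimal ⟨
    nlr 0 (as ++ N ∷ bs)   ≡⟨ nlr-split as as<N bs<N ⟩
    nlr 0 as + length bs   ≤⟨ +-monoˡ-≤ (length bs) nlr-as≤ ⟩
    nlr 0 s + length bs    ≡⟨ nlr-split s (All-resp-⊆ s⊆as as<N) bs<N ⟨
    nlr 0 (s ++ N ∷ bs)    ∎))
  where open ≤-Reasoning

-- If m preceded N, removing N would not turn any other entry into a left-to-right maximum.
minimal-second : ∀ {k as m N bs} → All (_< N) as → All (_< N) bs →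
                 Minimal k (as ++ N ∷ bs) → m ∈ as → ¬ All (_< m) bs
minimal-second {k} {as} {m} {N} {bs} as<N bs<N minimal@(_ , min) m∈as bs<m =
  contradiction (trans (sym (length-++-sucʳ as _ _)) (cong length (sym same))) 1+n≢n
  where
  bs<peak = All.map (λ b<m → <-≤-trans b<m (∈⇒≤peak 0 m∈as)) bs<m
  same : as ++ bs ≡ as ++ N ∷ bs
  same = min (⊆-++⁺ (⊆-refl {x = as}) (N ∷ʳ ⊆-refl)) (≤-reflexive (begin
    k                                ≡⟨ minimal-nlr minimal ⟨
    nlr 0 (as ++ N ∷ bs)             ≡⟨ nlr-split as as<N bs<N ⟩
    nlr 0 as + length bs             ≡⟨ cong (nlr 0 as +_) (nlr≡length bs<peak) ⟨
    nlr 0 as + nlr (peak 0 as) bs    ≡⟨ nlr-++ 0 as bs ⟨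
    nlr 0 (as ++ bs)                 ∎))
    where open ≡-Reasoning

-- A sublist keeping `N` gets at most k from `as` and at most one from each entry of `bs`, so it
-- reaches the bound only if it keeps everything. A sublist without `N` falls short.
minimal-++ : ∀ {k as m N bs} → All (_< m) as → All (_< N) as → All (_< N) bs → m ∈ bs → 
             Minimal k as → Minimal (k + length bs) (as ++ N ∷ bs)
minimal-++ {k} {as} {m} {N} {bs} as<m as<N bs<N m∈bs minimal@(k≤ , min) =
  ≤-trans (+-monoˡ-≤ (length bs) k≤) (≤-reflexive (sym (nlr-split as as<N bs<N)))
  , λ s⊆ k+|bs|≤ → unique (⊆-++⁻ as s⊆) k+|bs|≤
  where
  nlr-us≤ : ∀ {us} → us ⊆ as → nlr 0 us ≤ k
  nlr-us≤ us⊆as = ≤-trans (nlr-mono {0} {0} z≤n us⊆as) (≤-reflexive (minimal-nlr minimal))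

  unique : ∀ {s} → (∃ λ us → ∃ λ vs → s ≡ us ++ vs × us ⊆ as × vs ⊆ N ∷ bs) →
           k + length bs ≤ nlr 0 s → s ≡ as ++ N ∷ bs
  unique (us , _ ∷ vs , refl , us⊆as , refl ∷ vs⊆bs) k+|bs|≤ =
    cong₂ (λ u v → u ++ N ∷ v) us≡as (⊆-length-≤⇒≡ vs⊆bs |bs|≤|vs|)
    where
    k+|bs|≤′ = subst (k + length bs ≤_)
      (nlr-split us (All-resp-⊆ us⊆as as<N) (All-resp-⊆ vs⊆bs bs<N)) k+|bs|≤
    |bs|≤|vs| = +-cancelˡ-≤ k _ _ (≤-trans k+|bs|≤′ (+-monoˡ-≤ (length vs) (nlr-us≤ us⊆as)))
    us≡as = min us⊆as (+-cancelʳ-≤ (length bs) _ _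
      (≤-trans k+|bs|≤′ (+-monoʳ-≤ (nlr 0 us) (length-mono-≤ vs⊆bs))))
  -- Without `N`, nothing before `bs` exceeds `m`, so some entry of `bs` is a left-to-right maximum
  -- and the count stays below the bound.
  unique (us , vs , refl , us⊆as , _ ∷ʳ vs⊆bs) k+|bs|≤ =
    contradiction k+|bs|≤ (<⇒≱ (begin-strict
      nlr 0 (us ++ vs)          ≡⟨ nlr-++ 0 us vs ⟩
      nlr 0 us + nlr t vs       ≤⟨ +-mono-≤ (nlr-us≤ us⊆as) (nlr-mono {t} ≤-refl vs⊆bs) ⟩
      k + nlr t bs              <⟨ +-monoʳ-< k (nlr-<-length m∈bs t≤m) ⟩
      k + length bs             ∎))
    where
    open ≤-Reasoning
    t = peak 0 us
    t≤m : t ≤ m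
    t≤m = peak-≤ {0} z≤n (All.map <⇒≤ (All-resp-⊆ us⊆as as<m))

-- Invariance under order-preserving relabelling.

⊆-map⁻ : {A B : Set} (f : A → B) {xs : List A} {ys : List B} → ys ⊆ map f xs →
         ∃ λ zs → ys ≡ map f zs × zs ⊆ xs
⊆-map⁻ f {[]} [] = [] , refl , []
⊆-map⁻ f {x ∷ xs} (_ ∷ʳ ys⊆) with zs , eq , zs⊆ ← ⊆-map⁻ f ys⊆ = zs , eq , x ∷ʳ zs⊆
⊆-map⁻ f {x ∷ xs} (refl ∷ ys⊆) with zs , eq , zs⊆ ← ⊆-map⁻ f ys⊆ = x ∷ zs , cong (f x ∷_) eq , refl ∷ zs⊆

length-filter-∷ : {A : Set} {P : A → Set} (P? : ∀ x → Dec (P x)) (x : A) (xs : List A) →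
                  length (filter P? (x ∷ xs)) ≡ χ (P? x) + length (filter P? xs)
length-filter-∷ P? x xs with P? x
... | yes _ = refl
... | no _  = refl

module _ {f : ℕ → ℕ} (f-mono : ∀ {x y} → x < y → f x < f y) where

  mono⇒cancel-< : ∀ {x y} → f x < f y → x < y
  mono⇒cancel-< {x} {y} fx<fy with <-cmp x y
  ... | tri< x<y _ _ = x<y
  ... | tri≈ _ refl _ = contradiction fx<fy (<-irrefl refl)
  ... | tri> _ _ y<x = contradiction fx<fy (<-asym (f-mono y<x))

  mono⇒injective : ∀ {x y} → f x ≡ f y → x ≡ y
  mono⇒injective {x} {y} eq with <-cmp x y
  ... | tri< x<y _ _ = contradiction eq (<⇒≢ (f-mono x<y))
  ... | tri≈ _ x≡y _ = x≡y
  ... | tri> _ _ y<x = contradiction (sym eq) (<⇒≢ (f-mono y<x))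

  -- The threshold `u` need not be `f t`; it only has to separate the values of `f` as `t` separates
  -- the arguments. Thus 0 can be paired with 0 even if `f 0` is positive.
  nlr-map : ∀ {t u} → (∀ {x} → x < t → f x < u) → (∀ {x} → f x < u → x < t) →
            ∀ xs → nlr u (map f xs) ≡ nlr t xs
  nlr-map _ _ [] = refl
  nlr-map {t} {u} to from (x ∷ xs) =
    cong₂ _+_ (χ-cong (f x <? u) (x <? t) from to) (nlr-map to′ from′ xs)
    where
    to′ : ∀ {y} → y < t ⊔ x → f y < u ⊔ f x
    to′ y< = [ (λ y<t → <-≤-trans (to y<t) (m≤m⊔n u (f x)))
             , (λ y<x → <-≤-trans (f-mono y<x) (m≤n⊔m u (f x))) ]′ (m<n⊔o⇒m<n⊎m<o t x y<)
    from′ : ∀ {y} → f y < u ⊔ f x → y < t ⊔ x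
    from′ fy< = [ (λ fy<u → <-≤-trans (from fy<u) (m≤m⊔n t x))
                , (λ fy<fx → <-≤-trans (mono⇒cancel-< fy<fx) (m≤n⊔m t x)) ]′ (m<n⊔o⇒m<n⊎m<o u (f x) fy<)

  nlr-relabel : ∀ xs → nlr 0 (map f xs) ≡ nlr 0 xs
  nlr-relabel = nlr-map (λ ()) (λ ())

  minimal-relabel : ∀ {k xs} → Minimal k xs → Minimal k (map f xs)
  minimal-relabel {k} {xs} (k≤ , min) = subst (k ≤_) (sym (nlr-relabel xs)) k≤ , λ s⊆ k≤s →
    let zs , eq , zs⊆ = ⊆-map⁻ f s⊆
    in trans eq (cong (map f) (min zs⊆ (subst (k ≤_) (trans (cong (nlr 0) eq) (nlr-relabel zs)) k≤s)))

  minimal-relabel⁻ : ∀ {k xs} → Minimal k (map f xs) → Minimal k xs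
  minimal-relabel⁻ {k} {xs} (k≤ , min) = subst (k ≤_) (nlr-relabel xs) k≤ , λ {s} s⊆ k≤s →
    map-injective mono⇒injective (min (⊆-map⁺ f s⊆) (subst (k ≤_) (sym (nlr-relabel s)) k≤s))

  rank-relabel : ∀ x xs → length (filter (_<? f x) (map f xs)) ≡ length (filter (_<? x) xs)
  rank-relabel x [] = refl
  rank-relabel x (y ∷ xs) = begin
    length (filter (_<? f x) (f y ∷ map f xs))          ≡⟨ length-filter-∷ (_<? f x) (f y) (map f xs) ⟩
    χ (f y <? f x) + length (filter (_<? f x) (map f xs))
      ≡⟨ cong₂ _+_ (χ-cong (f y <? f x) (y <? x) mono⇒cancel-< f-mono) (rank-relabel x xs) ⟩
    χ (y <? x) + length (filter (_<? x) xs)             ≡⟨ length-filter-∷ (_<? x) y xs ⟨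
    length (filter (_<? x) (y ∷ xs))                    ∎
    where open ≡-Reasoning

  st-relabel : ∀ xs → st (map f xs) ≡ st xs
  st-relabel xs = trans (sym (map-∘ xs)) (map-cong (λ x → rank-relabel x xs) xs)

-- Increasing lists and standardisation.

Increasing : List ℕ → Set
Increasing = AllPairs _<_

upTo-increasing : ∀ n → Increasing (upTo n)
upTo-increasing n = applyUpTo⁺₁ id n (λ i<j _ → i<j)

sorted-unique : ∀ {xs ys} → AllPairs _≤_ xs → AllPairs _≤_ ys → xs ↭ ys → xs ≡ ys
sorted-unique xs↗ ys↗ xs↭ys =
  ≋⇒≡ (↗↭↗⇒≋ ≤-totalOrder (AllPairs⇒Sorted ≤-totalOrder xs↗) (AllPairs⇒Sorted ≤-totalOrder ys↗) (↭⇒↭ₛ xs↭ys))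

increasing-unique : ∀ {xs ys} → Increasing xs → Increasing ys → xs ↭ ys → xs ≡ ys
increasing-unique xs↗ ys↗ = sorted-unique (AllPairs.map <⇒≤ xs↗) (AllPairs.map <⇒≤ ys↗)

AllPairs-interleaving : {A : Set} {R : A → A → Set} {xs ys zs : List A} →
  Interleaving xs ys zs → AllPairs R zs → AllPairs R xs × AllPairs R ys
AllPairs-interleaving [] [] = [] , []
AllPairs-interleaving (consˡ i) (z∼ ∷ zs∼) with xs∼ , ys∼ ← AllPairs-interleaving i zs∼ =
  All.tabulate (All.lookup z∼ ∘ interleaving-∈ˡ i) ∷ xs∼ , ys∼
AllPairs-interleaving (consʳ i) (z∼ ∷ zs∼) with xs∼ , ys∼ ← AllPairs-interleaving i zs∼ =
  xs∼ , All.tabulate (All.lookup z∼ ∘ interleaving-∈ʳ i) ∷ ys∼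

-- Each entry of `zs` is traced back to `xs` or to `ys`. If `zs` is increasing, `us` and `vs` are
-- the sorted forms of the two lists.
++-↭⇒interleaving : {A : Set} (xs ys : List A) {zs : List A} → xs ++ ys ↭ zs →
  ∃ λ us → ∃ λ vs → Interleaving us vs zs × xs ↭ us × ys ↭ vs
++-↭⇒interleaving xs ys {[]} eq
  with refl ← ++-conicalˡ xs ys (↭-empty-inv eq) | refl ← ++-conicalʳ xs ys (↭-empty-inv eq) =
  [] , [] , [] , ↭-refl , ↭-refl
++-↭⇒interleaving xs ys {z ∷ zs} eq with ∈-++⁻ xs (∈-resp-↭ (↭-sym eq) (here refl))
... | inj₁ z∈xs
  with xs′ , xs↭ ← ∈⇒↭∷ z∈xs
  with us , vs , i , xs′↭us , ys↭vs ← ++-↭⇒interleaving xs′ ys (drop-∷ (↭-trans (↭-sym (++⁺ʳ ys xs↭)) eq)) =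
  z ∷ us , vs , consˡ i , ↭-trans xs↭ (prep z xs′↭us) , ys↭vs
... | inj₂ z∈ys
  with ys′ , ys↭ ← ∈⇒↭∷ z∈ys
  with us , vs , i , xs↭us , ys′↭vs ← ++-↭⇒interleaving xs ys′
         (drop-∷ (↭-trans (↭-sym (↭-trans (++⁺ (↭-refl {x = xs}) ys↭) (shift z xs ys′))) eq)) =
  us , z ∷ vs , consʳ i , xs↭us , ↭-trans ys↭ (prep z ys′↭vs)

-- Beyond the end of xs the values continue above all entries of xs, so the map stays strictly monotone.
relabel : ℕ → List ℕ → ℕ → ℕ
relabel N []       i       = N + i
relabel N (x ∷ xs) zero    = x
relabel N (x ∷ xs) (suc i) = relabel N xs i

relabel-> : ∀ {N x xs} → x < N → All (x <_) xs → ∀ i → x < relabel N xs i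
relabel-> x<N []          i       = <-≤-trans x<N (m≤m+n _ i)
relabel-> x<N (x<y ∷ _)   zero    = x<y
relabel-> x<N (_ ∷ x<xs)  (suc i) = relabel-> x<N x<xs i

relabel-mono : ∀ {N xs} → All (_< N) xs → Increasing xs → ∀ {i j} → i < j → relabel N xs i < relabel N xs j
relabel-mono {N} []        []         i<j               = +-monoʳ-< N i<j
relabel-mono (x<N ∷ _)     (x<xs ∷ _) {zero} {suc j} _  = relabel-> x<N x<xs j
relabel-mono (_ ∷ xs<N)    (_ ∷ xs↗)  {suc i} {suc j} (s≤s i<j) = relabel-mono xs<N xs↗ i<j

applyUpTo-relabel : ∀ N xs → applyUpTo (relabel N xs) (length xs) ≡ xs
applyUpTo-relabel N []       = refl
applyUpTo-relabel N (x ∷ xs) = cong (x ∷_) (applyUpTo-relabel N xs)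

Relabelling : List ℕ → Set
Relabelling xs = ∃ λ (f : ℕ → ℕ) → (∀ {i j} → i < j → f i < f j) × map f (upTo (length xs)) ≡ xs

relabelling : ∀ {xs} → Increasing xs → Relabelling xs
relabelling {xs} xs↗ =
  relabel N xs , relabel-mono (All.tabulate (s≤s ∘ ∈⇒≤peak 0)) xs↗
  , trans (map-upTo (relabel N xs) (length xs)) (applyUpTo-relabel N xs)
  where N = suc (peak 0 xs)

relabelled : ∀ {xs ys} ((f , _) : Relabelling xs) → ys ↭ xs →
             ∃ λ π → IsPerm π × length π ≡ length xs × ys ≡ map f π
relabelled {xs} (f , _ , eq) ys↭xs
  with π , refl , upTo↭π ← ↭-map-inv f (↭-trans (↭-reflexive eq) (↭-sym ys↭xs)) =
  π , subst (λ n → π ↭ upTo n) (sym |π|) (↭-sym upTo↭π) , |π| , refl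
  where |π| = trans (sym (↭-length upTo↭π)) (length-upTo (length xs))

complement : {A : Set} {xs ys : List A} → xs ⊆ ys → ∃ λ zs → Interleaving xs zs ys
complement [] = [] , []
complement (y ∷ʳ xs⊆ys)   with zs , i ← complement xs⊆ys = y ∷ zs , consʳ i
complement (refl ∷ xs⊆ys) with zs , i ← complement xs⊆ys = zs , consˡ i

-- In increasing order the entries of `s` form a sublist of `upTo`, and `f` enumerates them.
sublist-relabelled : ∀ {σ s} → IsPerm σ → s ⊆ σ →
  ∃ λ f → ∃ λ π → (∀ {i j} → i < j → f i < f j) × IsPerm π × s ≡ map f π
sublist-relabelled {σ} {s} σ↭ s⊆σ
  with zs , i ← complement s⊆σ
  with us , vs , j , s↭us , _ ← ++-↭⇒interleaving s zs (↭-trans (↭-sym (toPermutation i)) σ↭)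
  with r@(f , f-mono , _) ← relabelling (proj₁ (AllPairs-interleaving j (upTo-increasing (length σ))))
  with π , π-perm , _ , eq ← relabelled r s↭us = f , π , f-mono , π-perm , eq

rank-upTo : ∀ {x} n → x ≤ n → length (filter (_<? x) (upTo n)) ≡ x
rank-upTo zero z≤n = refl
rank-upTo {x} (suc n) x≤1+n with m≤n⇒m<n∨m≡n x≤1+n
... | inj₂ refl = trans (cong length (filter-all (_<? suc n) (all-upTo (suc n)))) (length-upTo (suc n))
... | inj₁ (s≤s x≤n) = begin
  length (filter (_<? x) (upTo (suc n)))          ≡⟨ cong (length ∘ filter (_<? x)) (upTo-∷ʳ n) ⟨
  length (filter (_<? x) (upTo n ++ n ∷ []))           ≡⟨ cong length (filter-++ (_<? x) (upTo n) (n ∷ [])) ⟩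
  length (filter (_<? x) (upTo n) ++ filter (_<? x) (n ∷ []))
    ≡⟨ cong (λ l → length (filter (_<? x) (upTo n) ++ l)) (filter-reject (_<? x) (≤⇒≯ x≤n)) ⟩
  length (filter (_<? x) (upTo n) ++ [])          ≡⟨ cong length (++-identityʳ (filter (_<? x) (upTo n))) ⟩
  length (filter (_<? x) (upTo n))                ≡⟨ rank-upTo n x≤n ⟩
  x                                               ∎
  where open ≡-Reasoning

-- Among the values 0, ..., n - 1 exactly x are smaller than x.
st-perm : ∀ {σ} → IsPerm σ → st σ ≡ σ
st-perm {σ} σ↭ = map-id-local (All.tabulate λ x∈ →
  trans (↭-length (filter-↭ (_<? _) σ↭)) (rank-upTo _ (<⇒≤ (∈-upTo⁻ (∈-resp-↭ σ↭ x∈)))))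

-- Writing `s` as `map f π` with `f` strictly increasing and `π` a permutation, `st s` is `st π`,
-- which is `π`.
nlr-st : ∀ {σ s} → IsPerm σ → s ⊆ σ → IsPerm (st s) × nlr 0 (st s) ≡ nlr 0 s
nlr-st σ↭ s⊆σ with f , π , f-mono , π↭ , refl ← sublist-relabelled σ↭ s⊆σ
  with st≡ ← trans (st-relabel f-mono π) (st-perm π↭) =
  subst IsPerm (sym st≡) π↭ , trans (cong (nlr 0) st≡) (sym (nlr-relabel f-mono π))

-- The classes `InC` and `InB` in terms of non-maxima.

jump-↭ : ∀ {σ τ} → RightJump σ τ → σ ↭ τ
jump-↭ (jump as x y bs cs) = ++⁺ (↭-refl {x = as}) (↭-sym (shift x (y ∷ bs) cs))

-- `Reach` is built from its first jump, whereas `nlr≤⇒InC` finds the last jump first.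
reach-∷ʳ : ∀ {k ρ σ τ} → Reach k ρ σ → RightJump σ τ → Reach (suc k) ρ τ
reach-∷ʳ done       j = step j done
reach-∷ʳ (step i r) j = step i (reach-∷ʳ r j)

nlr-reach : ∀ {k σ τ} → Reach k σ τ → nlr 0 τ ≤ k + nlr 0 σ
nlr-reach {k} done = m≤n+m _ k
nlr-reach {suc k} {σ} (step {τ' = ρ} j r) = ≤-trans (nlr-reach r)
  (subst (k + nlr 0 ρ ≤_) (+-suc k (nlr 0 σ)) (+-monoʳ-≤ k (nlr-jump j)))

InC⇒nlr≤ : ∀ {p σ} → InC p σ → nlr 0 σ ≤ p
InC⇒nlr≤ {p} {σ} r = subst (nlr 0 σ ≤_) (trans (cong (p +_) nlr-upTo) (+-identityʳ p)) (nlr-reach r)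
  where
  nlr-upTo : nlr 0 (upTo (length σ)) ≡ 0
  nlr-upTo = sorted⇒nlr≡0 (All.tabulate λ _ → z≤n) (AllPairs.map <⇒≤ (upTo-increasing (length σ)))

-- Each undone jump removes one non-maximum; a permutation without any is sorted and hence the
-- identity.
nlr≤⇒InC : ∀ p {σ} → IsPerm σ → nlr 0 σ ≤ p → InC p σ
nlr≤⇒InC p {σ} σ↭ nlr≤p with nlr 0 σ ≟ 0
... | yes nlr≡0 = subst (Reach p (upTo (length σ))) (sym σ≡upTo) done
  where
  σ≡upTo = sorted-unique (proj₂ (nlr≡0⇒sorted 0 σ nlr≡0)) (AllPairs.map <⇒≤ (upTo-increasing (length σ))) σ↭
nlr≤⇒InC zero _ nlr≤0 | no nlr≢0 = contradiction (n≤0⇒n≡0 nlr≤0) nlr≢0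
nlr≤⇒InC (suc p) {σ} σ↭ nlr≤1+p | no nlr≢0 with τ , j , nlr-τ ← undo-jump σ (n≢0⇒n>0 nlr≢0) =
  reach-∷ʳ (subst (λ n → Reach p (upTo n) τ) |τ|≡|σ|
    (nlr≤⇒InC p (subst (λ n → τ ↭ upTo n) (sym |τ|≡|σ|) (↭-trans (jump-↭ j) σ↭))
      (s≤s⁻¹ (≤-trans (≤-reflexive nlr-τ) nlr≤1+p)))) j
  where |τ|≡|σ| = ↭-length (jump-↭ j)

-- If `s` has more than p non-maxima, so has its standardisation, which therefore cannot be a proper
-- pattern. It equals σ, and comparing lengths gives that `s` is all of σ.
InB⇒minimal : ∀ {p σ} → InB p σ → Minimal (suc p) σ
InB⇒minimal {p} {σ} (σ↭ , σ∉C , patterns∈C) = ≰⇒> (σ∉C ∘ nlr≤⇒InC p σ↭) , λ {s} s⊆σ p<nlr →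
  let st≡σ = decidable-stable (≡-dec _≟_ (st s) σ) λ st≢σ →
        <⇒≱ p<nlr (subst (_≤ p) (proj₂ (nlr-st σ↭ s⊆σ)) (InC⇒nlr≤ (patterns∈C (st s) (s , s⊆σ , refl) st≢σ)))
  in ⊆-length-≤⇒≡ s⊆σ (≤-reflexive (trans (sym (cong length st≡σ)) (length-map _ s)))

minimal⇒InB : ∀ {p σ} → IsPerm σ → Minimal (suc p) σ → InB p σ
minimal⇒InB {p} {σ} σ↭ (p<nlr , min) = σ↭ , (λ σ∈C → <⇒≱ p<nlr (InC⇒nlr≤ σ∈C)) ,
  λ { π (s , s⊆σ , refl) st≢σ → let st↭ , nlr-st≡ = nlr-st σ↭ s⊆σ in
      nlr≤⇒InC p st↭ (≮⇒≥ λ p<nlr-st → 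
        st≢σ (trans (cong st (min s⊆σ (subst (suc p ≤_) nlr-st≡ p<nlr-st))) (st-perm σ↭))) }

-- Cutting a minimal permutation at its maximum.

increasing⇒unique : ∀ {xs} → Increasing xs → Unique xs
increasing⇒unique = AllPairs.map <⇒≢

upTo-suc-↭ : ∀ n → upTo (suc n) ↭ n ∷ upTo n
upTo-suc-↭ n = subst (_↭ n ∷ upTo n) (upTo-∷ʳ n) (++-comm (upTo n) (n ∷ []))

++-∷-injective : ∀ {N} as {bs} as′ {bs′} → All (_< N) as → All (_< N) as′ →
                 as ++ N ∷ bs ≡ as′ ++ N ∷ bs′ → as ≡ as′ × bs ≡ bs′
++-∷-injective []       []         _         _         eq = refl , ∷-injectiveʳ eq
++-∷-injective []       (x ∷ as′)  _         (x<N ∷ _) eq = contradiction (sym (∷-injectiveˡ eq)) (<⇒≢ x<N)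
++-∷-injective (x ∷ as) []         (x<N ∷ _) _         eq = contradiction (∷-injectiveˡ eq) (<⇒≢ x<N)
++-∷-injective (x ∷ as) (x′ ∷ as′) (_ ∷ as<N) (_ ∷ as′<N) eq
  with as≡as′ , bs≡bs′ ← ++-∷-injective as as′ as<N as′<N (∷-injectiveʳ eq) =
  cong₂ _∷_ (∷-injectiveˡ eq) as≡as′ , bs≡bs′

Pieces : Set
Pieces = (List ℕ × List ℕ) × (List ℕ × List ℕ)

-- A minimal permutation of length m + 2 is α followed by its maximum m + 1 and by β.
-- The last left-to-right maximum m + 1 is indispensable exactly when m comes after it, so
-- β consists of m and l further entries ts, and α of the remaining entries us.
IsPieces : ℕ → ℕ → ℕ → Pieces → Set
IsPieces m k l ((ts , us) , (β , α)) =
  Split (upTo m) l (ts , us) × β ↭ m ∷ ts × α ↭ us × Minimal k α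

assemble : ℕ → Pieces → List ℕ
assemble m (_ , (β , α)) = α ++ suc m ∷ β

pieces-α< : ∀ {m k l x} → IsPieces m k l x → All (_< m) (proj₂ (proj₂ x))
pieces-α< ((i , _) , _ , α↭ , _) = All.tabulate λ a∈ → ∈-upTo⁻ (interleaving-∈ʳ i (∈-resp-↭ α↭ a∈))

pieces-α<suc : ∀ {m k l x} → IsPieces m k l x → All (_< suc m) (proj₂ (proj₂ x))
pieces-α<suc pieces = All.map m<n⇒m<1+n (pieces-α< pieces)

pieces-β< : ∀ {m k l x} → IsPieces m k l x → All (_< suc m) (proj₁ (proj₂ x))
pieces-β< {m} {x = (ts , _) , _} ((i , _) , β↭ , _) = All.tabulate (bound ∘ ∈-resp-↭ β↭)
  where
  bound : ∀ {b} → b ∈ m ∷ ts → b < suc m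
  bound (here refl) = ≤-refl
  bound (there b∈)  = m<n⇒m<1+n (∈-upTo⁻ (interleaving-∈ˡ i b∈))

pieces-|β| : ∀ {m k l x} → IsPieces m k l x → length (proj₁ (proj₂ x)) ≡ suc l
pieces-|β| ((_ , |ts|) , β↭ , _) = trans (↭-length β↭) (cong suc |ts|)

assemble-↭ : ∀ {m k l x} → IsPieces m k l x → assemble m x ↭ upTo (2 + m)
assemble-↭ {m} {x = (ts , us) , (β , α)} ((i , _) , β↭ , α↭ , _) = begin
  α ++ suc m ∷ β          ↭⟨ shift (suc m) α β ⟩
  suc m ∷ α ++ β          ↭⟨ prep (suc m) (++⁺ α↭ β↭) ⟩
  suc m ∷ us ++ m ∷ ts    ↭⟨ prep (suc m) (shift m us ts) ⟩
  suc m ∷ m ∷ us ++ ts    ↭⟨ prep (suc m) (prep m (++-comm us ts)) ⟩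
  suc m ∷ m ∷ ts ++ us    ↭⟨ prep (suc m) (prep m (toPermutation i)) ⟨
  suc m ∷ m ∷ upTo m      ↭⟨ prep (suc m) (upTo-suc-↭ m) ⟨
  suc m ∷ upTo (suc m)    ↭⟨ upTo-suc-↭ (suc m) ⟨
  upTo (2 + m)            ∎
  where open PermutationReasoning

assemble-minimal : ∀ {m k l x} → IsPieces m k l x → Minimal (k + suc l) (assemble m x)
assemble-minimal {m} {k} {x = x} pieces@(_ , β↭ , _ , minimal) =
  subst (λ c → Minimal (k + c) (assemble m x)) (pieces-|β| pieces)
    (minimal-++ (pieces-α< pieces) (pieces-α<suc pieces) (pieces-β< pieces)
      (∈-resp-↭ (↭-sym β↭) (here refl)) minimal)

-- Both parts inherit the increasing order, so each is determined by its set of entries.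
split-unique : ∀ {xs l₁ l₂ ts₁ us₁ ts₂ us₂} → Increasing xs →
  Split xs l₁ (ts₁ , us₁) → Split xs l₂ (ts₂ , us₂) → ts₁ ↭ ts₂ → us₁ ↭ us₂ →
  (l₁ , (ts₁ , us₁)) ≡ (l₂ , (ts₂ , us₂))
split-unique xs↗ (i , refl) (j , refl) ts↭ us↭
  with ts₁↗ , us₁↗ ← AllPairs-interleaving i xs↗ | ts₂↗ , us₂↗ ← AllPairs-interleaving j xs↗
  with refl ← increasing-unique ts₁↗ ts₂↗ ts↭ | refl ← increasing-unique us₁↗ us₂↗ us↭ = refl

-- The position of `suc m` determines `α` and `β`; then `ts` is `β` without `m`, sorted, and `us` is
-- `α` sorted.
assemble-injective : ∀ {m k₁ k₂ l₁ l₂ x₁ x₂} → IsPieces m k₁ l₁ x₁ → IsPieces m k₂ l₂ x₂ →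
                     assemble m x₁ ≡ assemble m x₂ → (l₁ , x₁) ≡ (l₂ , x₂)
assemble-injective {m} {x₁ = _ , (β₁ , α₁)} {x₂ = _ , (β₂ , α₂)}
                   p₁@(s₁ , β₁↭ , α₁↭ , _) p₂@(s₂ , β₂↭ , α₂↭ , _) eq
  with refl , refl ← ++-∷-injective α₁ α₂ (pieces-α<suc p₁) (pieces-α<suc p₂) eq
  with refl ← split-unique (upTo-increasing m) s₁ s₂
                (drop-∷ (↭-trans (↭-sym β₁↭) β₂↭)) (↭-trans (↭-sym α₁↭) α₂↭) = refl

-- Surjectivity of `assemble`. The parameter for `α` is its own number of non-maxima; the remaining
-- `suc l` are the entries of `β`.
minimal⇒pieces : ∀ {m k σ} → σ ↭ upTo (2 + m) → Minimal k σ →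
  ∃ λ l → ∃ λ x → IsPieces m (nlr 0 (proj₂ (proj₂ x))) l x ×
    nlr 0 (proj₂ (proj₂ x)) + suc l ≡ k × assemble m x ≡ σ
minimal⇒pieces {m} {k} {σ} σ↭ minimal
  with α , β , refl ← ∈-∃++ (∈-resp-↭ (↭-sym σ↭) (∈-upTo⁺ {i = suc m} ≤-refl)) =
  from-m∈β m∈β
  where
  α++β↭ : α ++ β ↭ upTo (suc m)
  α++β↭ = drop-∷ (↭-trans (↭-sym (shift (suc m) α β)) (↭-trans σ↭ (upTo-suc-↭ (suc m))))

  α< : All (_< suc m) α
  α< = All.tabulate λ a∈ → ∈-upTo⁻ (∈-resp-↭ α++β↭ (∈-++⁺ˡ a∈))

  β< : All (_< suc m) β
  β< = All.tabulate λ b∈ → ∈-upTo⁻ (∈-resp-↭ α++β↭ (∈-++⁺ʳ α b∈))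

  m∈β : m ∈ β
  m∈β with m ∈? β
  ... | yes m∈β = m∈β
  ... | no m∉β with ∈-++⁻ α (∈-resp-↭ (↭-sym α++β↭) (∈-upTo⁺ {i = m} ≤-refl))
  ...   | inj₂ m∈β = m∈β
  -- Entries of `β` are at most `m`; if `m` is not among them, all are below it, and `suc m` could
  -- be removed.
  ...   | inj₁ m∈α = contradiction
          (All.tabulate λ b∈ → ≤∧≢⇒< (s≤s⁻¹ (All.lookup β< b∈)) λ { refl → m∉β b∈ })
          (minimal-second α< β< minimal m∈α)

  from-m∈β : m ∈ β → _
  from-m∈β m∈β
    with β′ , β↭ ← ∈⇒↭∷ m∈β
    with ts , us , i , β′↭ , α↭ ← ++-↭⇒interleaving β′ α
           (drop-∷ (↭-trans (++⁺ʳ α (↭-sym β↭)) (↭-trans (++-comm β α) (↭-trans α++β↭ (upTo-suc-↭ m)))))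
    with pieces ← (i , refl {x = length ts}) , ↭-trans β↭ (prep m β′↭) , α↭ , minimal-prefix α α< β< minimal =
    length ts , ((ts , us) , (β , α)) , pieces
    , trans (cong (nlr 0 α +_) (sym (pieces-|β| pieces))) (trans (sym (nlr-split α α< β<)) (minimal-nlr minimal))
    , refl

-- Counting the sets `Bnp`.

Bnp⇒ : ∀ {n p σ} → Bnp n p σ → σ ↭ upTo n × Minimal (suc p) σ
Bnp⇒ {σ = σ} (|σ| , σ∈B@(σ↭ , _)) = subst (λ n → σ ↭ upTo n) |σ| σ↭ , InB⇒minimal σ∈B

⇒Bnp : ∀ {n p σ} → σ ↭ upTo n → Minimal (suc p) σ → Bnp n p σ
⇒Bnp {n} {σ = σ} σ↭ minimal = |σ| , minimal⇒InB (subst (λ n → σ ↭ upTo n) (sym |σ|) σ↭) minimal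
  where |σ| = trans (↭-length σ↭) (length-upTo n)

-- The first entry is always a left-to-right maximum, so a nonempty list of length n has at most n -
-- 1 non-maxima, while p + 1 are required.
Bnp-empty : ∀ n p → p + 2 > n → ∀ σ → ¬ Bnp n p σ
Bnp-empty n p n<p+2 [] (_ , σ∈B) = contradiction (proj₁ (InB⇒minimal σ∈B)) λ ()
Bnp-empty n p n<p+2 (x ∷ xs) (refl , σ∈B) = <⇒≱ n<p+2
  (subst (_≤ n) (+-comm 2 p) (≤-trans (s≤s (proj₁ (InB⇒minimal σ∈B))) (nlr-0-<-length x xs)))

-- With all entries but one non-maxima, the largest comes first and the others follow in any order.
card-Bnp-top : ∀ m → Card (suc m !) (Bnp (2 + m) m)
card-Bnp-top m = card-image (suc m ∷_) (λ _ _ → ∷-injectiveʳ) to onto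
  (card-↭ (suc m) (Uniqueₚ.upTo⁺ (suc m)) (length-upTo (suc m)))
  where
  to : ∀ β → β ↭ upTo (suc m) → Bnp (2 + m) m (suc m ∷ β)
  to β β↭ = ⇒Bnp (↭-trans (prep (suc m) β↭) (↭-sym (upTo-suc-↭ (suc m))))
    (subst (λ k → Minimal k (suc m ∷ β)) (trans (↭-length β↭) (length-upTo (suc m)))
      (minimal-++ [] [] (All.tabulate (∈-upTo⁻ ∘ ∈-resp-↭ β↭))
        (∈-resp-↭ (↭-sym β↭) (∈-upTo⁺ {i = m} ≤-refl)) minimal-0))

  onto : ∀ σ → Bnp (2 + m) m σ → ∃ λ β → β ↭ upTo (suc m) × suc m ∷ β ≡ σ
  onto σ σ∈B with σ↭ , minimal ← Bnp⇒ σ∈B with minimal⇒pieces σ↭ minimal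
  ... | l , (_ , (β , [])) , _ , _ , refl = β , drop-∷ (↭-trans σ↭ (upTo-suc-↭ (suc m))) , refl
  -- A nonempty prefix before `suc m` would contribute a second left-to-right maximum, one too many.
  ... | l , (_ , (β , a ∷ α)) , pieces , eq , refl = contradiction
    (suc-injective (begin
      suc (length α + suc (length β))          ≡⟨ cong suc (length-++ α) ⟨
      length (a ∷ α ++ suc m ∷ β)              ≡⟨ trans (↭-length σ↭) (length-upTo (2 + m)) ⟩
      2 + m                                    ≡⟨ cong suc eq ⟨
      suc (nlr 0 (a ∷ α) + suc l)              ≡⟨ cong (λ c → suc (nlr 0 (a ∷ α) + c)) (pieces-|β| pieces) ⟨
      suc (nlr 0 (a ∷ α) + length β)           ∎))
    (>⇒≢ (subst (nlr 0 (a ∷ α) + length β <_) (sym (+-suc (length α) (length β)))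
      (+-monoˡ-< (length β) (nlr-0-<-length a α))))
    where open ≡-Reasoning

card-relabelled : ∀ {k q us} → Increasing us → Card k (Bnp (length us) q) →
                  Card k (λ α → α ↭ us × Minimal (suc q) α)
card-relabelled {us = us} us↗ with r@(f , f-mono , eq) ← relabelling us↗ =
  card-image (map f)
    (λ _ _ → map-injective (mono⇒injective f-mono))
    (λ π π∈B → let π↭ , minimal = Bnp⇒ π∈B in
      ↭-trans (↭-map⁺ f π↭) (↭-reflexive eq) , minimal-relabel f-mono minimal)
    (λ { α (α↭ , minimal) → let π , π↭ , |π| , α≡ = relabelled r α↭ in
      π , (|π| , minimal⇒InB π↭ (minimal-relabel⁻ f-mono (subst (Minimal _) α≡ minimal))) , sym α≡ })

-- The factors count the choices of `ts`, the orders of `m ∷ ts` and the minimal arrangements of the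
-- remaining entries.
card-pieces : ∀ m l {k q} → Card k (Bnp (m ∸ l) q) →
              Card ((m C l) * (suc l ! * k)) (IsPieces m (suc q) l)
card-pieces m l {k} {q} card-α =
  subst (λ n → Card ((n C l) * (suc l ! * k)) (IsPieces m (suc q) l)) (length-upTo m)
  (card-× (card-Split (Uniqueₚ.upTo⁺ m) l) inner)
  where
  inner : ∀ {s} → Split (upTo m) l s →
          Card (suc l ! * k) (λ (β , α) → β ↭ m ∷ proj₁ s × α ↭ proj₂ s × Minimal (suc q) α)
  inner {ts , us} (i , |ts|) with ts↗ , us↗ ← AllPairs-interleaving i (upTo-increasing m) =
    card-× (card-↭ (suc l)
                    (All.tabulate (>⇒≢ ∘ ∈-upTo⁻ ∘ interleaving-∈ˡ i) ∷ increasing⇒unique ts↗) (cong suc |ts|))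
           (λ _ → card-relabelled us↗ (subst (λ n → Card k (Bnp n q)) |us| card-α))
    where
    |us| : m ∸ l ≡ length us
    |us| = begin
      m ∸ l                           ≡⟨ cong₂ _∸_ (length-upTo m) |ts| ⟨
      length (upTo m) ∸ length ts
        ≡⟨ cong (_∸ length ts) (trans (↭-length (toPermutation i)) (length-++ ts)) ⟩
      length ts + length us ∸ length ts ≡⟨ m+n∸m≡n (length ts) (length us) ⟩
      length us                       ∎
      where open ≡-Reasoning

p∸l∸1+1+l≡p : ∀ {l p} → l < p → p ∸ l ∸ 1 + suc l ≡ p
p∸l∸1+1+l≡p {l} {p} l<p = begin
  p ∸ l ∸ 1 + suc l     ≡⟨ cong (_+ suc l) (trans (∸-+-assoc p l 1) (cong (p ∸_) (+-comm l 1))) ⟩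
  p ∸ suc l + suc l     ≡⟨ m∸n+n≡m l<p ⟩
  p                     ∎
  where open ≡-Reasoning

-- Of the p + 1 non-maxima, l + 1 form `β`. So `α` has p - l of them and corresponds to a member of
-- the set with index p - l - 1.
card-Bnp : ∀ {m p} (b : ℕ → ℕ → ℕ) → (∀ n q → Card (b n q) (Bnp n q)) → p < m →
  Card (sum (map (λ l → (m C l) * (suc l ! * b (m ∸ l) (p ∸ l ∸ 1))) (upTo p))) (Bnp (2 + m) p)
card-Bnp {m} {p} b counts p<m =
  card-image (λ (_ , x) → assemble m x)
    (λ (_ , x) (_ , y) → assemble-injective x y)
    (λ (l , x) (l∈ , pieces) → ⇒Bnp (assemble-↭ pieces)
      (subst (λ k → Minimal k (assemble m x)) (cong suc (p∸l∸1+1+l≡p (∈-upTo⁻ l∈))) (assemble-minimal pieces)))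
    onto
    (card-Σ (Uniqueₚ.upTo⁺ p) (λ {l} _ → card-pieces m l (counts (m ∸ l) (p ∸ l ∸ 1))))
  where
  Assembled : List ℕ → Set
  Assembled σ = ∃ λ ((l , x) : ℕ × Pieces) →
    (l ∈ upTo p × IsPieces m (suc (p ∸ l ∸ 1)) l x) × assemble m x ≡ σ

  onto : ∀ σ → Bnp (2 + m) p σ → Assembled σ
  onto σ σ∈B with σ↭ , minimal ← Bnp⇒ σ∈B with minimal⇒pieces σ↭ minimal
  ... | l , x@(_ , (β , α)) , pieces , eq , refl = from-nlr (nlr 0 α) refl
    where
    from-nlr : ∀ c → nlr 0 α ≡ c → Assembled (assemble m x)
    -- If `α` has no non-maxima it is empty, which forces p = m; this is excluded by `p<m`.
    from-nlr zero nlr≡0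
      with refl ← minimal-0⁻ (subst (λ c → Minimal c α) nlr≡0 (proj₂ (proj₂ (proj₂ pieces)))) =
      contradiction (trans (sym eq)
        (suc-injective (trans (cong suc (sym (pieces-|β| pieces))) (trans (↭-length σ↭) (length-upTo (2 + m))))))
        (<⇒≢ (s≤s p<m))
    from-nlr (suc q) nlr≡ = (l , x) , (∈-upTo⁺ l<p , subst (λ c → IsPieces m c l x) nlr≡′ pieces) , refl
      where
      q+1+l≡p : q + suc l ≡ p
      q+1+l≡p = suc-injective (trans (cong (_+ suc l) (sym nlr≡)) eq)
      l<p : l < p
      l<p = subst (suc l ≤_) q+1+l≡p (m≤n+m (suc l) q)
      nlr≡′ : nlr 0 α ≡ suc (p ∸ l ∸ 1)
      nlr≡′ = +-cancelʳ-≡ (suc l) _ _ (trans eq (cong suc (sym (p∸l∸1+1+l≡p l<p))))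

-- The recurrence and the vanishing range.

sum-zero : ∀ {f : ℕ → ℕ} xs → (∀ {x} → x ∈ xs → f x ≡ 0) → sum (map f xs) ≡ 0
sum-zero []       _   = refl
sum-zero (x ∷ xs) f≡0 = cong₂ _+_ (f≡0 (here refl)) (sum-zero xs (f≡0 ∘ there))

Recurrence : (ℕ → ℕ → ℕ) → Set
Recurrence b = ∀ n p → p + 2 < n →
  b n p ≡ sum (map (λ ℓ → ((ℓ + 1) !) * ((n ∸ 2) C ℓ) * b (n ∸ ℓ ∸ 2) (p ∸ ℓ ∸ 1)) (upTo p))

recurrence : ∀ b → (∀ n p → Counts (b n p) (Bnp n p)) → Recurrence b
recurrence b counts n p p+2<n with m , refl ← m≤n⇒∃[o]m+o≡n {2} (≤-trans (m≤n+m 2 p) (<⇒≤ p+2<n)) =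
  trans (card-unique (counts (2 + m) p) (card-Bnp b counts p<m) (λ _ → id) (λ _ → id))
        (cong sum (map-cong summand (upTo p)))
  where
  p<m : p < m
  p<m = +-cancelˡ-< 2 p m (subst (_< 2 + m) (+-comm p 2) p+2<n)
  summand : ∀ l → (m C l) * (suc l ! * b (m ∸ l) (p ∸ l ∸ 1)) ≡
                  ((l + 1) !) * (m C l) * b (2 + m ∸ l ∸ 2) (p ∸ l ∸ 1)
  summand l = begin
    (m C l) * (suc l ! * b (m ∸ l) (p ∸ l ∸ 1))               ≡⟨ *-assoc (m C l) _ _ ⟨
    (m C l) * suc l ! * b (m ∸ l) (p ∸ l ∸ 1)
      ≡⟨ cong (_* b (m ∸ l) (p ∸ l ∸ 1)) (*-comm (m C l) _) ⟩
    suc l ! * (m C l) * b (m ∸ l) (p ∸ l ∸ 1)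
      ≡⟨ cong₂ (λ i j → (i !) * (m C l) * b j (p ∸ l ∸ 1)) (+-comm 1 l)
           (sym (trans (∸-+-assoc (2 + m) l 2) (cong (2 + m ∸_) (+-comm l 2)))) ⟩
    ((l + 1) !) * (m C l) * b (2 + m ∸ l ∸ 2) (p ∸ l ∸ 1)     ∎
    where open ≡-Reasoning

-- Strong induction on p: in each summand the bound 2p + 2 drops by 2l + 2 but the length only by l
-- + 2, so the strict inequality persists and every summand vanishes.
recurrence⇒vanishing : ∀ b → Recurrence b → ∀ p n → 2 * p + 2 < n → b n p ≡ 0
recurrence⇒vanishing b rec = <-rec _ λ p ih n 2p+2<n →
  trans (rec n p (≤-<-trans (+-monoˡ-≤ 2 (m≤n*m p 2)) 2p+2<n))
    (sum-zero (upTo p) λ {l} l∈ → trans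
      (cong (((l + 1) !) * ((n ∸ 2) C l) *_) (ih (smaller (∈-upTo⁻ l∈)) _ (larger (∈-upTo⁻ l∈) 2p+2<n)))
      (*-zeroʳ (((l + 1) !) * ((n ∸ 2) C l))))
  where
  smaller : ∀ {l p} → l < p → p ∸ l ∸ 1 < p
  smaller {l} {p} l<p = subst (p ∸ l ∸ 1 <_) (p∸l∸1+1+l≡p l<p)
    (m<m+n (p ∸ l ∸ 1) (s≤s z≤n))
  larger : ∀ {l p n} → l < p → 2 * p + 2 < n → 2 * (p ∸ l ∸ 1) + 2 < n ∸ l ∸ 2
  larger {l} {p} {n} l<p 2p+2<n = subst (2 * q + 2 <_) (sym (∸-+-assoc n l 2))
    (m+n≤o⇒m≤o∸n (suc (2 * q + 2)) (begin
      -- The added `l` is the difference between 2l + 2 and l + 2.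
      suc (2 * q + 2) + (l + 2)     ≤⟨ m≤m+n _ l ⟩
      suc (2 * q + 2) + (l + 2) + l ≡⟨ solve 2 (λ q l → con 1 :+ (con 2 :* q :+ con 2) :+ (l :+ con 2) :+ l
                                        := con 1 :+ (con 2 :* (q :+ (con 1 :+ l)) :+ con 2)) refl q l ⟩
      suc (2 * (q + suc l) + 2)     ≡⟨ cong (λ p → suc (2 * p + 2)) (p∸l∸1+1+l≡p l<p) ⟩
      suc (2 * p + 2)               ≤⟨ 2p+2<n ⟩
      n                             ∎))
    where
    open ≤-Reasoning
    open +-*-Solver
    q = p ∸ l ∸ 1

theorem3 : (b : ℕ → ℕ → ℕ) →
    (∀ n p → Counts (b n p) (Bnp n p)) →
    (∀ n p → p + 2 < n →
    b n p ≡ sum (map (λ ℓ → ((ℓ + 1) !) * ((n ∸ 2) C ℓ) * b (n ∸ ℓ ∸ 2) (p ∸ ℓ ∸ 1)) (upTo p)))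
    × (∀ n p → 2 * p + 2 < n → b n p ≡ 0)
    × (∀ n p → p + 2 > n → b n p ≡ 0)
    × (∀ n → n > 1 → b n (n ∸ 2) ≡ (n ∸ 1) !)
theorem3 b counts =
  recurrence b counts
  , (λ n p → recurrence⇒vanishing b (recurrence b counts) p n)
  , (λ n p n<p+2 → card-unique (counts n p) (card-∅ (Bnp-empty n p n<p+2)) (λ _ → id) (λ _ → id))
  , (λ { (suc zero) (s≤s ())
       ; (suc (suc m)) _ → card-unique (counts (2 + m) m) (card-Bnp-top m) (λ _ → id) (λ _ → id) })
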